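{- There exists a lattice polytope of dimension $14$ in $\mathbb{R}^{14}$ that is hollow with respect to $\mathbb{Z}^{14}$ and has lattice width $15$, and there exists a lattice simplex of dimension $404$ in $\mathbb{R}^{404}$ that is hollow with respect to $\mathbb{Z}^{404}$ and has lattice width $408$.
   Context: A lattice polytope is a polytope whose vertices lie in the lattice. A convex body $K\subset\mathbb{R}^d$ is hollow with respect to $\mathbb{Z}^d$ if its interior contains no point of $\mathbb{Z}^d$. The lattice width of $K$ is $\inf_{f\in(\mathbb{Z}^d)^*\setminus\{0\}}(\max_K f-\min_K f)$, the infimum over nonzero integer linear functionals. -}

module Defs where

open import Data.Nat using (ℕ; zero; suc)
open import Data.Fin using (Fin; zero; suc)
open import Data.Integer using (ℤ; +_)
open import Data.Rational using (ℚ; 0ℚ; 1ℚ; _+_; _*_; _-_; _≤_; _<_; _/_; ∣_∣)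
open import Data.Empty using (⊥)
open import Data.Product using (Σ; ∃; _×_; _,_)
open import Relation.Binary.PropositionalEquality using (_≡_; _≢_)

ι : ℤ → ℚ
ι z = z / 1

sumℚ : ∀ {n} → (Fin n → ℚ) → ℚ
sumℚ {zero}  f = 0ℚ
sumℚ {suc n} f = f zero + sumℚ (λ i → f (suc i))

Pointℚ : ℕ → Set
Pointℚ d = Fin d → ℚ

LatticePoint : ℕ → Set
LatticePoint d = Fin d → ℤ

toℚ : ∀ {d} → LatticePoint d → Pointℚ d
toℚ v j = ι (v j)

InConv : ∀ {d m} → (Fin m → LatticePoint d) → Pointℚ d → Set
InConv {d} {m} V y =
  Σ (Fin m → ℚ) λ λs →
    (∀ i → 0ℚ ≤ λs i) × (sumℚ λs ≡ 1ℚ) ×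
    (∀ j → sumℚ (λ i → λs i * ι (V i j)) ≡ y j)

-- x lies in the interior of conv V: some open ℓ∞-box around x is contained in the polytope
-- (tested on rational points, which are dense)
InInterior : ∀ {d m} → (Fin m → LatticePoint d) → Pointℚ d → Set
InInterior {d} V x =
  Σ ℚ λ ε → (0ℚ < ε) ×
    (∀ (y : Pointℚ d) → (∀ j → ∣ y j - x j ∣ < ε) → InConv V y)

Hollow : ∀ {d m} → (Fin m → LatticePoint d) → Set
Hollow {d} V = ∀ (z : LatticePoint d) → InInterior V (toℚ z) → ⊥

AffinelyIndependent : ∀ {d k} → (Fin k → LatticePoint d) → Set
AffinelyIndependent {d} W =
  ∀ (c : Fin _ → ℚ) → sumℚ c ≡ 0ℚ → (∀ j → sumℚ (λ i → c i * ι (W i j)) ≡ 0ℚ) →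
    ∀ i → c i ≡ 0ℚ

FullDimensional : ∀ {d m} → (Fin m → LatticePoint d) → Set
FullDimensional {d} {m} V =
  Σ (Fin (suc d) → Fin m) λ s → AffinelyIndependent (λ i → V (s i))

Nonzero : ∀ {d} → (Fin d → ℤ) → Set
Nonzero {d} f = ∃ λ (i : Fin d) → f i ≢ + 0

eval : ∀ {d} → (Fin d → ℤ) → Pointℚ d → ℚ
eval f x = sumℚ (λ j → ι (f j) * x j)

LatticeWidth : ∀ {d m} → (Fin m → LatticePoint d) → ℕ → Set
LatticeWidth {d} V w =
  (∀ (f : Fin d → ℤ) → Nonzero f →
     Σ (Pointℚ d) λ x → Σ (Pointℚ d) λ y →
       InConv V x × InConv V y × (ι (+ w) ≤ eval f x - eval f y))
  ×
  (Σ (Fin d → ℤ) λ f → Nonzero f ×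
     (∀ x y → InConv V x → InConv V y → eval f x - eval f y ≤ ι (+ w)))

{-# OPTIONS --safe #-}

-- Let T ⊂ ℝᵈ be a lattice polytope containing 0 whose interior avoids n ℤᵈ. The direct sum of n copies of T,
-- the convex hull of their union with the i-th copy in the i-th summand of (ℝᵈ)ⁿ, has the lattice width of T,
-- and it is hollow: of the n weights of a point of the sum one is at most 1/n, so the component of an interior
-- point in that copy lies in the interior of T/n. For dimension 14 = 7 · 2 take a triangle of width 15 avoiding
-- 7 ℤ². For dimension 404 = 101 · 4 dilate an empty 4-simplex with vertex 0, width 4 and normalised volume 101
-- by 102: the barycentric coordinates of lattice points in the empty simplex are multiples of 1/101, so
-- dilating it by 102/101 does not bring a lattice point into the interior.
module Submission where

open import Defs
open import Data.Nat as ℕ using (ℕ; zero; suc)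
import Data.Nat.DivMod as ℕ
import Data.Nat.Properties as ℕ
open import Data.Fin using (Fin; zero; suc; combine; remQuot; toℕ; fromℕ<; _↑ˡ_; _↑ʳ_)
import Data.Fin.Properties as Fin
open import Data.Integer as ℤ using (ℤ; +_; -[1+_])
import Data.Integer.Properties as ℤ
open import Data.Integer.Tactic.RingSolver using (solve-∀)
open import Data.Rational
  using (ℚ; 0ℚ; 1ℚ; _+_; _*_; _-_; -_; _≤_; _<_; ∣_∣; toℚᵘ; 1/_; Positive; positive; nonNegative)
import Data.Rational.Properties as ℚ
open import Data.Rational.Solver using (module +-*-Solver)
open +-*-Solver using (solve; _:+_; _:*_; _:-_; _:=_; con)
open import Data.Rational.Unnormalised as ℚᵘ using (mkℚᵘ; *≡*; *≤*; *<*)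
import Data.Rational.Unnormalised.Properties as ℚᵘ
open import Data.Empty using (⊥)
open import Data.Product using (Σ; ∃; ∃₂; _×_; _,_; proj₁; proj₂)
open import Data.Vec using ([]; _∷_; lookup)
open import Function using (_∘_; case_of_)
open import Relation.Binary.PropositionalEquality
open import Relation.Nullary using (Dec; yes; no; ¬_; contradiction)
open import Relation.Nullary.Decidable using (toWitness; map′; _×-dec_; _→-dec_; ¬?)

-- Rational numbers and finite sums

-- `z / 1` normalises by a gcd and is stuck on a variable `z`. Unnormalised rationals have the
-- literal fraction with denominator 1, so the laws of `ι` are proved there.
toℚᵘ-ι : ∀ z → toℚᵘ (ι z) ℚᵘ.≃ mkℚᵘ z 0
toℚᵘ-ι z = ℚ.toℚᵘ-fromℚᵘ (mkℚᵘ z 0)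

ι-+ : ∀ a b → ι (a ℤ.+ b) ≡ ι a + ι b
ι-+ a b = ℚ.toℚᵘ-injective (begin
  toℚᵘ (ι (a ℤ.+ b))              ≈⟨ toℚᵘ-ι (a ℤ.+ b) ⟩
  mkℚᵘ (a ℤ.+ b) 0                ≈⟨ *≡* (eq a b) ⟩
  mkℚᵘ a 0 ℚᵘ.+ mkℚᵘ b 0          ≈⟨ ℚᵘ.+-cong (toℚᵘ-ι a) (toℚᵘ-ι b) ⟨
  toℚᵘ (ι a) ℚᵘ.+ toℚᵘ (ι b)      ≈⟨ ℚ.toℚᵘ-homo-+ (ι a) (ι b) ⟨
  toℚᵘ (ι a + ι b)                ∎)
  where
  open ℚᵘ.≃-Reasoning
  eq : ∀ a b → (a ℤ.+ b) ℤ.* + 1 ≡ (a ℤ.* + 1 ℤ.+ b ℤ.* + 1) ℤ.* + 1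
  eq = solve-∀

ι-* : ∀ a b → ι (a ℤ.* b) ≡ ι a * ι b
ι-* a b = ℚ.toℚᵘ-injective (begin
  toℚᵘ (ι (a ℤ.* b))              ≈⟨ toℚᵘ-ι (a ℤ.* b) ⟩
  mkℚᵘ a 0 ℚᵘ.* mkℚᵘ b 0          ≈⟨ ℚᵘ.*-cong (toℚᵘ-ι a) (toℚᵘ-ι b) ⟨
  toℚᵘ (ι a) ℚᵘ.* toℚᵘ (ι b)      ≈⟨ ℚ.toℚᵘ-homo-* (ι a) (ι b) ⟨
  toℚᵘ (ι a * ι b)                ∎)
  where open ℚᵘ.≃-Reasoning

ι-neg : ∀ a → ι (ℤ.- a) ≡ - ι a
ι-neg a = ℚ.toℚᵘ-injective (begin
  toℚᵘ (ι (ℤ.- a))     ≈⟨ toℚᵘ-ι (ℤ.- a) ⟩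
  ℚᵘ.- mkℚᵘ a 0        ≈⟨ ℚᵘ.-‿cong (toℚᵘ-ι a) ⟨
  ℚᵘ.- toℚᵘ (ι a)      ≈⟨ ℚ.toℚᵘ-homo‿- (ι a) ⟨
  toℚᵘ (- ι a)         ∎)
  where open ℚᵘ.≃-Reasoning

ι-- : ∀ a b → ι (a ℤ.- b) ≡ ι a - ι b
ι-- a b = trans (ι-+ a (ℤ.- b)) (cong (λ t → ι a + t) (ι-neg b))

ι-mono-≤ : ∀ {a b} → a ℤ.≤ b → ι a ≤ ι b
ι-mono-≤ {a} {b} a≤b = ℚ.toℚᵘ-cancel-≤
  (ℚᵘ.≤-respˡ-≃ (ℚᵘ.≃-sym (toℚᵘ-ι a)) (ℚᵘ.≤-respʳ-≃ (ℚᵘ.≃-sym (toℚᵘ-ι b))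
    (*≤* (ℤ.*-monoʳ-≤-nonNeg (+ 1) a≤b))))

ι-mono-< : ∀ {a b} → a ℤ.< b → ι a < ι b
ι-mono-< {a} {b} a<b = ℚ.toℚᵘ-cancel-<
  (ℚᵘ.<-respˡ-≃ (ℚᵘ.≃-sym (toℚᵘ-ι a)) (ℚᵘ.<-respʳ-≃ (ℚᵘ.≃-sym (toℚᵘ-ι b))
    (*<* (ℤ.*-monoʳ-<-pos (+ 1) a<b))))

sum-cong : ∀ {n} {f g : Fin n → ℚ} → (∀ i → f i ≡ g i) → sumℚ f ≡ sumℚ g
sum-cong {zero}  f≗g = refl
sum-cong {suc n} f≗g = cong₂ _+_ (f≗g zero) (sum-cong (f≗g ∘ suc))

sum-0 : ∀ n → sumℚ {n} (λ _ → 0ℚ) ≡ 0ℚ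
sum-0 zero    = refl
sum-0 (suc n) = trans (ℚ.+-identityˡ _) (sum-0 n)

sum-≡0 : ∀ {n} {f : Fin n → ℚ} → (∀ i → f i ≡ 0ℚ) → sumℚ f ≡ 0ℚ
sum-≡0 {n} f≗0 = trans (sum-cong f≗0) (sum-0 n)

sum-+ : ∀ {n} (f g : Fin n → ℚ) → sumℚ (λ i → f i + g i) ≡ sumℚ f + sumℚ g
sum-+ {zero}  f g = refl
sum-+ {suc n} f g = trans (cong (λ t → f zero + g zero + t) (sum-+ (f ∘ suc) (g ∘ suc)))
  (solve 4 (λ a b c d → a :+ b :+ (c :+ d) := a :+ c :+ (b :+ d)) refl
    (f zero) (g zero) (sumℚ (f ∘ suc)) (sumℚ (g ∘ suc)))

*-sum : ∀ {n} c (f : Fin n → ℚ) → c * sumℚ f ≡ sumℚ (λ i → c * f i)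
*-sum {zero}  c f = ℚ.*-zeroʳ c
*-sum {suc n} c f = trans (ℚ.*-distribˡ-+ c (f zero) _) (cong (λ t → c * f zero + t) (*-sum c (f ∘ suc)))

sum-* : ∀ {n} c (f : Fin n → ℚ) → sumℚ f * c ≡ sumℚ (λ i → f i * c)
sum-* c f = trans (ℚ.*-comm _ c) (trans (*-sum c f) (sum-cong (λ i → ℚ.*-comm c (f i))))

sum-mono-≤ : ∀ {n} {f g : Fin n → ℚ} → (∀ i → f i ≤ g i) → sumℚ f ≤ sumℚ g
sum-mono-≤ {zero}  f≤g = ℚ.≤-refl
sum-mono-≤ {suc n} f≤g = ℚ.+-mono-≤ (f≤g zero) (sum-mono-≤ (f≤g ∘ suc))

sum-nonNeg : ∀ {n} {f : Fin n → ℚ} → (∀ i → 0ℚ ≤ f i) → 0ℚ ≤ sumℚ f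
sum-nonNeg {n} 0≤f = subst (λ t → t ≤ sumℚ {n} _) (sum-0 n) (sum-mono-≤ 0≤f)

term≤sum : ∀ {n} {f : Fin n → ℚ} → (∀ i → 0ℚ ≤ f i) → ∀ i → f i ≤ sumℚ f
term≤sum {suc n} {f} 0≤f zero = subst (λ t → t ≤ sumℚ f) (ℚ.+-identityʳ (f zero))
  (ℚ.+-monoʳ-≤ (f zero) (sum-nonNeg (0≤f ∘ suc)))
term≤sum {suc n} {f} 0≤f (suc i) = ℚ.≤-trans (term≤sum (0≤f ∘ suc) i)
  (subst (λ t → t ≤ sumℚ f) (ℚ.+-identityˡ (sumℚ (f ∘ suc)))
    (ℚ.+-monoˡ-≤ (sumℚ (f ∘ suc)) (0≤f zero)))

sum-swap : ∀ {m n} (f : Fin m → Fin n → ℚ) →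
  sumℚ (λ i → sumℚ (f i)) ≡ sumℚ (λ j → sumℚ (λ i → f i j))
sum-swap {zero}  {n} f = sym (sum-0 n)
sum-swap {suc m} {n} f = trans (cong (λ t → sumℚ (f zero) + t) (sum-swap (f ∘ suc)))
  (sym (sum-+ (f zero) _))

sum-only : ∀ {n} {f : Fin n → ℚ} i → (∀ j → i ≢ j → f j ≡ 0ℚ) → sumℚ f ≡ f i
sum-only {suc n} {f} zero others = trans
  (cong (λ t → f zero + t) (sum-≡0 (λ j → others (suc j) λ ())))
  (ℚ.+-identityʳ (f zero))
sum-only {suc n} {f} (suc i) others = trans
  (cong₂ _+_ (others zero λ ()) (sum-only i (λ j i≢j → others (suc j) (i≢j ∘ Fin.suc-injective))))
  (ℚ.+-identityˡ (f (suc i)))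

sum-++ : ∀ m {n} (f : Fin (m ℕ.+ n) → ℚ) →
  sumℚ f ≡ sumℚ (λ i → f (i ↑ˡ n)) + sumℚ (λ j → f (m ↑ʳ j))
sum-++ zero    f = sym (ℚ.+-identityˡ (sumℚ f))
sum-++ (suc m) f = trans (cong (λ t → f zero + t) (sum-++ m (f ∘ suc))) (sym (ℚ.+-assoc (f zero) _ _))

sum-combine : ∀ n {k} (f : Fin (n ℕ.* k) → ℚ) →
  sumℚ f ≡ sumℚ (λ (a : Fin n) → sumℚ (λ b → f (combine a b)))
sum-combine zero    f = refl
sum-combine (suc n) {k} f = trans (sum-++ k f) (cong (λ t → sumℚ (λ b → f (b ↑ˡ n ℕ.* k)) + t) (sum-combine n (f ∘ (k ↑ʳ_))))

below-average : ∀ n (f : Fin (suc n) → ℚ) c → sumℚ f ≤ ι (+ suc n) * c → ∃ λ i → f i ≤ c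
below-average n f c Σf≤ with f zero ℚ.≤? c
... | yes f₀≤c = zero , f₀≤c
below-average zero f c Σf≤ | no f₀≰c = contradiction
  (subst₂ _≤_ (ℚ.+-identityʳ (f zero)) (ℚ.*-identityˡ c) Σf≤) f₀≰c
below-average (suc n) f c Σf≤ | no f₀≰c =
  -- Were the tail sum above `ι (+ suc n) * c`, adding `f zero`, itself above `c`, would break the
  -- assumed bound.
  let i , fi≤c = below-average n (f ∘ suc) c (ℚ.≮⇒≥ λ ltᵣ → ℚ.<-irrefl refl (ℚ.<-≤-trans
        (subst (λ t → t < sumℚ f) eq (ℚ.+-mono-< (ℚ.≰⇒> f₀≰c) ltᵣ)) Σf≤))
  in suc i , fi≤c
  where
  eq : c + ι (+ suc n) * c ≡ ι (+ suc (suc n)) * c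
  eq = trans (cong (λ t → t + ι (+ suc n) * c) (sym (ℚ.*-identityˡ c)))
    (trans (sym (ℚ.*-distribʳ-+ c 1ℚ (ι (+ suc n)))) (cong (λ t → t * c) (sym (ι-+ (+ 1) (+ suc n)))))

-- Integer linear functionals

evalℤ : ∀ {d} → (Fin d → ℤ) → LatticePoint d → ℤ
evalℤ {zero}  f v = + 0
evalℤ {suc d} f v = f zero ℤ.* v zero ℤ.+ evalℤ (f ∘ suc) (v ∘ suc)

eval-toℚ : ∀ {d} (f : Fin d → ℤ) v → eval f (toℚ v) ≡ ι (evalℤ f v)
eval-toℚ {zero}  f v = refl
eval-toℚ {suc d} f v = sym (trans (ι-+ (f zero ℤ.* v zero) _)
  (cong₂ _+_ (ι-* (f zero) (v zero)) (sym (eval-toℚ (f ∘ suc) (v ∘ suc)))))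

eval-cong : ∀ {d} (f : Fin d → ℤ) {x y : Pointℚ d} → (∀ j → x j ≡ y j) → eval f x ≡ eval f y
eval-cong f x≗y = sum-cong (λ j → cong (λ t → ι (f j) * t) (x≗y j))

eval-comb : ∀ {d m} (f : Fin d → ℤ) (c : Fin m → ℚ) (V : Fin m → LatticePoint d) →
  eval f (λ j → sumℚ (λ i → c i * ι (V i j))) ≡ sumℚ (λ i → c i * eval f (toℚ (V i)))
eval-comb {d} {m} f c V = begin
  sumℚ (λ j → ι (f j) * sumℚ (λ i → c i * ι (V i j)))   ≡⟨ sum-cong (λ j → *-sum {m} (ι (f j)) _) ⟩
  sumℚ (λ j → sumℚ (λ i → ι (f j) * (c i * ι (V i j)))) ≡⟨ sum-swap {d} {m} _ ⟩
  sumℚ (λ i → sumℚ (λ j → ι (f j) * (c i * ι (V i j)))) ≡⟨ sum-cong (λ i → sum-cong (λ j →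
      solve 3 (λ a b c → a :* (b :* c) := b :* (a :* c)) refl (ι (f j)) (c i) (ι (V i j)))) ⟩
  sumℚ (λ i → sumℚ (λ j → c i * (ι (f j) * ι (V i j)))) ≡⟨ sum-cong (λ i → *-sum {d} (c i) _) ⟨
  sumℚ (λ i → c i * eval f (toℚ (V i)))                 ∎
  where open ≡-Reasoning

-- For positive `c` and `δ` the argument on the left lies beyond `x` on the ray from `p / c`,
-- because `c * x - p` is `c` times `x - p / c`. This form avoids a division.
eval-overshoot : ∀ {d} (f : Fin d → ℤ) (x p : Pointℚ d) δ c →
  eval f (λ j → x j + δ * (c * x j - p j)) ≡ eval f x + δ * (c * eval f x - eval f p)
eval-overshoot {zero}  f x p δ c = sym (solve 2 (λ δ c → con 0ℚ :+ δ :* (c :* con 0ℚ :- con 0ℚ) := con 0ℚ) refl δ c)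
eval-overshoot {suc d} f x p δ c = trans
  (cong (λ t → ι (f zero) * (x zero + δ * (c * x zero - p zero)) + t) (eval-overshoot (f ∘ suc) (x ∘ suc) (p ∘ suc) δ c))
  (solve 7 (λ g a b δ c s r → g :* (a :+ δ :* (c :* a :- b)) :+ (s :+ δ :* (c :* s :- r))
      := g :* a :+ s :+ δ :* (c :* (g :* a :+ s) :- (g :* b :+ r))) refl
    (ι (f zero)) (x zero) (p zero) δ c (eval (f ∘ suc) (x ∘ suc)) (eval (f ∘ suc) (p ∘ suc)))

-- Direct sums of copies of a polytope with the origin

withOrigin : ∀ {d m} → (Fin m → LatticePoint d) → Fin (suc m) → LatticePoint d
withOrigin V zero    j = + 0
withOrigin V (suc i) j = V i j

-- The index is a pair so that `Fin.remQuot-combine` can be applied by `cong` before the split on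
-- `a Fin.≟ a′`.
embedAt : ∀ {n d} → Fin n → LatticePoint d → Fin n × Fin d → ℤ
embedAt a v (a′ , b) with a Fin.≟ a′
... | yes _ = v b
... | no  _ = + 0

embed : ∀ {n d} → Fin n → LatticePoint d → LatticePoint (n ℕ.* d)
embed {n} {d} a v = embedAt a v ∘ remQuot {n} d

diagonal : ∀ n {d k} → (Fin k → LatticePoint d) → Fin (n ℕ.* k) → LatticePoint (n ℕ.* d)
diagonal n {k = k} T i = let a , e = remQuot {n} k i in embed a (T e)

-- The shared origin is listed once. With linearly independent `T` it is a vertex of the resulting
-- simplex; with the triangle it lies on an edge of every copy and does not change the hull.
directSum : ∀ n {d k} → (Fin k → LatticePoint d) → Fin (suc (n ℕ.* k)) → LatticePoint (n ℕ.* d)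
directSum n T = withOrigin (diagonal n T)

blockOf : ∀ {n d} {A : Set} → Fin n → (Fin (n ℕ.* d) → A) → Fin d → A
blockOf a f b = f (combine a b)

combine-elim : ∀ {n d} (P : Fin (n ℕ.* d) → Set) → (∀ a b → P (combine a b)) → ∀ i → P i
combine-elim {n} {d} P h i = let a , b , eq = Fin.combine-surjective {n} {d} i in subst P eq (h a b)

embed-same : ∀ {n d} (a : Fin n) (v : LatticePoint d) b → embed a v (combine a b) ≡ v b
embed-same a v b = trans (cong (embedAt a v) (Fin.remQuot-combine a b)) same
  where
  same : embedAt a v (a , b) ≡ v b
  same with a Fin.≟ a
  ... | yes _  = refl
  ... | no a≢a = contradiction refl a≢a

embed-other : ∀ {n d} (a a′ : Fin n) (v : LatticePoint d) b → a ≢ a′ → embed a v (combine a′ b) ≡ + 0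
embed-other a a′ v b a≢a′ = trans (cong (embedAt a v) (Fin.remQuot-combine a′ b)) other
  where
  other : embedAt a v (a′ , b) ≡ + 0
  other with a Fin.≟ a′
  ... | yes a≡a′ = contradiction a≡a′ a≢a′
  ... | no _     = refl

diagonal-combine : ∀ {n d k} (T : Fin k → LatticePoint d) (a : Fin n) e →
  diagonal n T (combine a e) ≡ embed a (T e)
diagonal-combine T a e = cong (λ (a , e) → embed a (T e)) (Fin.remQuot-combine a e)

eval-origin : ∀ {d} (f : Fin d → ℤ) → eval f (toℚ (λ _ → + 0)) ≡ 0ℚ
eval-origin f = sum-≡0 (λ j → ℚ.*-zeroʳ (ι (f j)))

*-ι0 : ∀ c {z} → z ≡ + 0 → c * ι z ≡ 0ℚ
*-ι0 c refl = ℚ.*-zeroʳ c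

eval-embed : ∀ {n d} (f : Fin (n ℕ.* d) → ℤ) (a : Fin n) (v : LatticePoint d) →
  eval f (toℚ (embed a v)) ≡ eval (blockOf a f) (toℚ v)
eval-embed {n} {d} f a v = begin
  eval f (toℚ (embed a v))
    ≡⟨ sum-combine n {d} (λ j → ι (f j) * ι (embed a v j)) ⟩
  sumℚ inBlock
    ≡⟨ sum-only {n} {inBlock} a (λ a′ a≢a′ → sum-≡0 λ b →
         *-ι0 (ι (f (combine a′ b))) (embed-other a a′ v b a≢a′)) ⟩
  inBlock a
    ≡⟨ sum-cong (λ b → cong (λ t → ι (f (combine a b)) * ι t) (embed-same a v b)) ⟩
  eval (blockOf a f) (toℚ v) ∎
  where
  open ≡-Reasoning
  inBlock : Fin n → ℚ
  inBlock a′ = sumℚ {d} (λ b → ι (f (combine a′ b)) * ι (embed a v (combine a′ b)))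

sum-directSum : ∀ n {k} (f : Fin (suc (n ℕ.* k)) → ℚ) →
  sumℚ f ≡ f zero + sumℚ (λ (a : Fin n) → sumℚ (blockOf a (f ∘ suc)))
sum-directSum n f = cong (λ t → f zero + t) (sum-combine n (f ∘ suc))

-- Each listed point vanishes outside its own block, so only the weights of copy `a` survive in
-- block `a`.
directSum-coordinate : ∀ n {d k} (T : Fin k → LatticePoint d) (c : Fin (suc (n ℕ.* k)) → ℚ) (a : Fin n) b →
  sumℚ (λ i → c i * ι (directSum n T i (combine a b))) ≡ sumℚ (λ e → blockOf a (c ∘ suc) e * ι (T e b))
directSum-coordinate n {d} {k} T c a b = begin
  sumℚ (λ i → c i * ι (directSum n T i (combine a b)))
    ≡⟨ sum-directSum n {k} (λ i → c i * ι (directSum n T i (combine a b))) ⟩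
  c zero * 0ℚ + sumℚ (λ (a′ : Fin n) → sumℚ {k} (λ e → c (suc (combine a′ e)) * ι (diagonal n T (combine a′ e) (combine a b))))
    ≡⟨ cong₂ _+_ (ℚ.*-zeroʳ (c zero)) (sum-cong λ (a′ : Fin n) → sum-cong λ e →
         cong (λ v → c (suc (combine a′ e)) * ι (v (combine a b))) (diagonal-combine T a′ e)) ⟩
  0ℚ + sumℚ inBlock
    ≡⟨ ℚ.+-identityˡ (sumℚ inBlock) ⟩
  sumℚ inBlock
    ≡⟨ sum-only {n} {inBlock} a (λ a′ a≢a′ → sum-≡0 λ e →
         *-ι0 (c (suc (combine a′ e))) (embed-other a′ a (T e) b (a≢a′ ∘ sym))) ⟩
  inBlock a
    ≡⟨ sum-cong (λ e → cong (λ t → c (suc (combine a e)) * ι t) (embed-same a (T e) b)) ⟩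
  sumℚ (λ e → blockOf a (c ∘ suc) e * ι (T e b)) ∎
  where
  open ≡-Reasoning
  inBlock : Fin n → ℚ
  inBlock a′ = sumℚ {k} (λ e → c (suc (combine a′ e)) * ι (embed a′ (T e) (combine a b)))

-- Dimension of direct sums

LinearlyIndependent : ∀ {d k} → (Fin k → LatticePoint d) → Set
LinearlyIndependent {d} {k} T =
  ∀ (c : Fin k → ℚ) → (∀ b → sumℚ (λ e → c e * ι (T e b)) ≡ 0ℚ) → ∀ e → c e ≡ 0ℚ

-- The coordinates of one block form a combination of `T` alone, so the weights of every copy
-- vanish. The weight of the origin then vanishes because all weights add up to 0.
directSum-affinelyIndependent : ∀ n {d k} (T : Fin k → LatticePoint d) →
  LinearlyIndependent T → AffinelyIndependent (directSum n T)
directSum-affinelyIndependent n {k = k} T indep c Σc≡0 combination≡0 = λ where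
    zero    → trans (sym (ℚ.+-identityʳ (c zero)))
                (trans (cong (λ t → c zero + t) (sym (sum-≡0 rest))) Σc≡0)
    (suc i) → rest i
  where
  rest : ∀ i → c (suc i) ≡ 0ℚ
  rest = combine-elim {n} {k} (λ i → c (suc i) ≡ 0ℚ) λ a → indep (blockOf a (c ∘ suc)) λ b →
    trans (sym (directSum-coordinate n T c a b)) (combination≡0 (combine a b))

c*pos≡0⇒c≡0 : ∀ c D → c * ι (+ suc D) ≡ 0ℚ → c ≡ 0ℚ
c*pos≡0⇒c≡0 c D eq = ℚ.≤-antisym
  (ℚ.*-cancelʳ-≤-pos (ι (+ suc D)) {{pos}} (ℚ.≤-reflexive (trans eq (sym (ℚ.*-zeroˡ (ι (+ suc D)))))))
  (ℚ.*-cancelʳ-≤-pos (ι (+ suc D)) {{pos}} (ℚ.≤-reflexive (trans (ℚ.*-zeroˡ (ι (+ suc D))) (sym eq))))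
  where
  pos : Positive (ι (+ suc D))
  pos = positive (ι-mono-< {+ 0} {+ suc D} (ℤ.+<+ (ℕ.s≤s ℕ.z≤n)))

-- `φ` is a dual family cleared of denominators: applied to a vanishing combination, `φ e` leaves
-- only `c e` times `suc D`.
dual⇒linearlyIndependent : ∀ {d k} (T φ : Fin k → LatticePoint d) D →
  (∀ e → evalℤ (φ e) (T e) ≡ + suc D) → (∀ e e′ → e ≢ e′ → evalℤ (φ e) (T e′) ≡ + 0) →
  LinearlyIndependent T
dual⇒linearlyIndependent T φ D on-diagonal off-diagonal c combination≡0 e = c*pos≡0⇒c≡0 (c e) D (begin
  c e * ι (+ suc D)                            ≡⟨ cong (λ t → c e * ι t) (on-diagonal e) ⟨
  c e * ι (evalℤ (φ e) (T e))                  ≡⟨ cong (c e *_) (eval-toℚ (φ e) (T e)) ⟨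
  c e * eval (φ e) (toℚ (T e))                 ≡⟨ sum-only e (λ e′ e≢e′ → trans
                                                    (cong (c e′ *_) (trans (eval-toℚ (φ e) (T e′)) (cong ι (off-diagonal e e′ e≢e′))))
                                                    (ℚ.*-zeroʳ (c e′))) ⟨
  sumℚ (λ e′ → c e′ * eval (φ e) (toℚ (T e′))) ≡⟨ eval-comb (φ e) c T ⟨
  eval (φ e) (λ j → sumℚ (λ e′ → c e′ * ι (T e′ j))) ≡⟨ eval-cong (φ e) combination≡0 ⟩
  eval (φ e) (λ _ → 0ℚ)                        ≡⟨ eval-origin (φ e) ⟩
  0ℚ                                           ∎)
  where open ≡-Reasoning

affinelyIndependent-cong : ∀ {d k} {V W : Fin k → LatticePoint d} → (∀ i j → V i j ≡ W i j) →
  AffinelyIndependent V → AffinelyIndependent W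
affinelyIndependent-cong V≗W indep c Σc≡0 combination≡0 = indep c Σc≡0 λ j →
  trans (sum-cong λ i → cong (λ t → c i * ι t) (V≗W i j)) (combination≡0 j)

-- `T` may have more than `d` vectors, as the triangle does; the basis picked by `s` is repeated in
-- every copy and joined with the origin.
directSum-fullDimensional : ∀ n {d k} (T : Fin k → LatticePoint d) (s : Fin d → Fin k) →
  LinearlyIndependent (T ∘ s) → FullDimensional (directSum n T)
directSum-fullDimensional n {d} {k} T s indep = pick , affinelyIndependent-cong eq
  (directSum-affinelyIndependent n (T ∘ s) indep)
  where
  pick : Fin (suc (n ℕ.* d)) → Fin (suc (n ℕ.* k))
  pick zero    = zero
  pick (suc i) = let a , b = remQuot {n} d i in suc (combine a (s b))
  eq : ∀ i j → directSum n (T ∘ s) i j ≡ directSum n T (pick i) j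
  eq zero    j = refl
  eq (suc i) j = let a , b = remQuot {n} d i in sym (cong (λ v → v j) (diagonal-combine T a (s b)))

-- Lattice width of direct sums

vertex∈conv : ∀ {d m} (V : Fin m → LatticePoint d) i → InConv V (toℚ (V i))
vertex∈conv {m = m} V i = δ , 0≤δ , trans (sum-only i δ-other) δ-same , λ j → δ-sum* (λ i′ → ι (V i′ j))
  where
  δ : Fin m → ℚ
  δ i′ with i Fin.≟ i′
  ... | yes _ = 1ℚ
  ... | no  _ = 0ℚ
  0≤δ : ∀ i′ → 0ℚ ≤ δ i′
  0≤δ i′ with i Fin.≟ i′
  ... | yes _ = ι-mono-≤ {+ 0} {+ 1} (ℤ.+≤+ ℕ.z≤n)
  ... | no  _ = ℚ.≤-refl
  δ-same : δ i ≡ 1ℚ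
  δ-same with i Fin.≟ i
  ... | yes _  = refl
  ... | no i≢i = contradiction refl i≢i
  δ-other : ∀ i′ → i ≢ i′ → δ i′ ≡ 0ℚ
  δ-other i′ i≢i′ with i Fin.≟ i′
  ... | yes i≡i′ = contradiction i≡i′ i≢i′
  ... | no _     = refl
  δ-sum* : ∀ h → sumℚ (λ i′ → δ i′ * h i′) ≡ h i
  δ-sum* h = trans
    (sum-only i (λ i′ i≢i′ → trans (cong (_* h i′) (δ-other i′ i≢i′)) (ℚ.*-zeroˡ (h i′))))
    (trans (cong (_* h i) δ-same) (ℚ.*-identityˡ (h i)))

eval-conv : ∀ {d m} (V : Fin m → LatticePoint d) (f : Fin d → ℤ) x (x∈ : InConv V x) →
  eval f x ≡ sumℚ (λ i → proj₁ x∈ i * eval f (toℚ (V i)))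
eval-conv V f x (λs , _ , _ , Σλv≡x) = trans (eval-cong f (λ j → sym (Σλv≡x j))) (eval-comb f λs V)

sum-convex : ∀ {m} (λs : Fin m → ℚ) c → sumℚ λs ≡ 1ℚ → sumℚ (λ i → λs i * c) ≡ c
sum-convex λs c Σλ≡1 = trans (sym (sum-* c λs)) (trans (cong (_* c) Σλ≡1) (ℚ.*-identityˡ c))

conv-≤ : ∀ {d m} (V : Fin m → LatticePoint d) (f : Fin d → ℤ) c →
  (∀ i → eval f (toℚ (V i)) ≤ c) → ∀ x → InConv V x → eval f x ≤ c
conv-≤ V f c f≤c x x∈@(λs , 0≤λ , Σλ≡1 , _) = subst₂ _≤_ (sym (eval-conv V f x x∈)) (sum-convex λs c Σλ≡1)
  (sum-mono-≤ (λ i → ℚ.*-monoˡ-≤-nonNeg (λs i) {{nonNegative (0≤λ i)}} (f≤c i)))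

conv-≥ : ∀ {d m} (V : Fin m → LatticePoint d) (f : Fin d → ℤ) c →
  (∀ i → c ≤ eval f (toℚ (V i))) → ∀ x → InConv V x → c ≤ eval f x
conv-≥ V f c c≤f x x∈@(λs , 0≤λ , Σλ≡1 , _) = subst₂ _≤_ (sum-convex λs c Σλ≡1) (sym (eval-conv V f x x∈))
  (sum-mono-≤ (λ i → ℚ.*-monoˡ-≤-nonNeg (λs i) {{nonNegative (0≤λ i)}} (c≤f i)))

atVertex : ∀ {n k} → Fin n → Fin (suc k) → Fin (suc (n ℕ.* k))
atVertex a zero    = zero
atVertex a (suc e) = suc (combine a e)

eval-atVertex : ∀ n {d k} (T : Fin k → LatticePoint d) f (a : Fin n) e →
  eval f (toℚ (directSum n T (atVertex a e))) ≡ ι (evalℤ (blockOf a f) (withOrigin T e))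
eval-atVertex n T f a zero = trans (eval-origin f)
  (trans (sym (eval-origin (blockOf a f))) (eval-toℚ (blockOf a f) (withOrigin T zero)))
eval-atVertex n T f a (suc e) = trans (cong (λ v → eval f (toℚ v)) (diagonal-combine T a e))
  (trans (eval-embed f a (T e)) (eval-toℚ (blockOf a f) (T e)))

-- Only integer values at the listed points are compared, which makes the property decidable.
Wide : ∀ {d m} → ℕ → (Fin m → LatticePoint d) → (Fin d → ℤ) → Set
Wide w V f = ∃₂ λ i i′ → + w ℤ.≤ evalℤ f (V i) ℤ.- evalℤ f (V i′)

-- A nonzero functional is nonzero on some block, and the copy there already spreads its values by
-- `w`. For the upper bound, `f₀` placed in the first block is 0 on all other copies, and 0 lies
-- between `lo` and `hi`.
directSum-width : ∀ n {d k} (T : Fin k → LatticePoint d) w →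
  (∀ f → Nonzero f → Wide w (withOrigin T) f) →
  (f₀ : Fin d → ℤ) → Nonzero f₀ → ∀ lo hi → lo ℤ.≤ + 0 → + 0 ℤ.≤ hi → hi ℤ.- lo ℤ.≤ + w →
  (∀ e → lo ℤ.≤ evalℤ f₀ (T e) × evalℤ f₀ (T e) ℤ.≤ hi) →
  LatticeWidth (directSum (suc n) T) w
directSum-width n {d} {k} T w wide f₀ (b₀ , f₀b₀≢0) lo hi lo≤0 0≤hi hi-lo≤w range = lower , upper
  where
  V = directSum (suc n) T
  lower : ∀ f → Nonzero f → Σ (Pointℚ (suc n ℕ.* d)) λ x → Σ (Pointℚ (suc n ℕ.* d)) λ y →
    InConv V x × InConv V y × (ι (+ w) ≤ eval f x - eval f y)
  lower f (i , fi≢0) =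
    let a , b , ab≡i = Fin.combine-surjective {suc n} {d} i
        e , e′ , w≤ = wide (blockOf a f) (b , subst (λ j → f j ≢ + 0) (sym ab≡i) fi≢0)
        v = atVertex a e
        v′ = atVertex a e′
    in toℚ (V v) , toℚ (V v′) , vertex∈conv V v , vertex∈conv V v′ ,
       subst (ι (+ w) ≤_)
         (trans (ι-- (evalℤ (blockOf a f) (withOrigin T e)) (evalℤ (blockOf a f) (withOrigin T e′)))
           (cong₂ _-_ (sym (eval-atVertex (suc n) T f a e)) (sym (eval-atVertex (suc n) T f a e′))))
         (ι-mono-≤ w≤)

  F : LatticePoint (suc n ℕ.* d)
  F = embed {suc n} {d} zero f₀
  F-range : ∀ a e → ι lo ≤ eval F (toℚ (diagonal (suc n) T (combine {suc n} {k} a e))) ×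
                    eval F (toℚ (diagonal (suc n) T (combine {suc n} {k} a e))) ≤ ι hi
  F-range a e = subst (λ t → ι lo ≤ t × t ≤ ι hi) (sym (eval-atVertex (suc n) T F a (suc e)))
    (subst (λ t → ι lo ≤ t × t ≤ ι hi) (eval-toℚ (blockOf a F) (T e)) (inBlock a))
    where
    inBlock : ∀ a → ι lo ≤ eval (blockOf a F) (toℚ (T e)) × eval (blockOf a F) (toℚ (T e)) ≤ ι hi
    inBlock zero = subst (λ t → ι lo ≤ t × t ≤ ι hi)
      (sym (trans (sum-cong λ b → cong (λ t → ι t * ι (T e b)) (embed-same {suc n} zero f₀ b)) (eval-toℚ f₀ (T e))))
      (ι-mono-≤ (proj₁ (range e)) , ι-mono-≤ (proj₂ (range e)))
    inBlock (suc a) = subst (λ t → ι lo ≤ t × t ≤ ι hi)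
      (sym (sum-≡0 λ b → trans (cong (λ t → ι t * ι (T e b)) (embed-other zero (suc a) f₀ b λ ())) (ℚ.*-zeroˡ (ι (T e b)))))
      (ι-mono-≤ lo≤0 , ι-mono-≤ 0≤hi)
  V-range : ∀ i → ι lo ≤ eval F (toℚ (V i)) × eval F (toℚ (V i)) ≤ ι hi
  V-range zero    = subst (λ t → ι lo ≤ t × t ≤ ι hi) (sym (eval-origin F)) (ι-mono-≤ lo≤0 , ι-mono-≤ 0≤hi)
  V-range (suc i) = combine-elim {suc n} {k}
    (λ i → ι lo ≤ eval F (toℚ (V (suc i))) × eval F (toℚ (V (suc i))) ≤ ι hi) F-range i

  upper : Σ (Fin (suc n ℕ.* d) → ℤ) λ f → Nonzero f ×
    (∀ x y → InConv V x → InConv V y → eval f x - eval f y ≤ ι (+ w))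
  upper = F , (combine {suc n} {d} zero b₀ , f₀b₀≢0 ∘ trans (sym (embed-same {suc n} zero f₀ b₀))) , λ x y x∈ y∈ →
    ℚ.≤-trans
      (ℚ.+-mono-≤ (conv-≤ V F (ι hi) (proj₂ ∘ V-range) x x∈)
        (ℚ.neg-antimono-≤ (conv-≥ V F (ι lo) (proj₁ ∘ V-range) y y∈)))
      (subst (_≤ ι (+ w)) (ι-- hi lo) (ι-mono-≤ hi-lo≤w))

-- Hollowness of direct sums

∣∣-bound : ∀ {m} (p : Fin m → ℚ) → ∃ λ M → 0ℚ < M × (∀ i → ∣ p i ∣ < M)
-- The summand 1 makes the bound positive, hence invertible, and strict.
∣∣-bound p = 1ℚ + S ,
  ℚ.<-≤-trans 0<1 (subst (_≤ 1ℚ + S) (ℚ.+-identityʳ 1ℚ) (ℚ.+-monoʳ-≤ 1ℚ (sum-nonNeg λ i → ℚ.0≤∣p∣ (p i)))) ,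
  λ i → ℚ.≤-<-trans (term≤sum (λ i → ℚ.0≤∣p∣ (p i)) i) (subst (_< 1ℚ + S) (ℚ.+-identityˡ S) (ℚ.+-monoˡ-< S 0<1))
  where
  S = sumℚ (λ i → ∣ p i ∣)
  0<1 : 0ℚ < 1ℚ
  0<1 = ι-mono-< {+ 0} {+ 1} (ℤ.+<+ (ℕ.s≤s ℕ.z≤n))

small-multiple : ∀ {m} (p : Fin m → ℚ) ε → 0ℚ < ε → ∃ λ δ → 0ℚ < δ × (∀ i → ∣ δ * p i ∣ < ε)
small-multiple p ε 0<ε with ∣∣-bound p
... | M , 0<M , p<M = δ , ℚ.positive⁻¹ δ , λ i → begin-strict
    ∣ δ * p i ∣     ≡⟨ ℚ.∣p*q∣≡∣p∣*∣q∣ δ (p i) ⟩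
    ∣ δ ∣ * ∣ p i ∣ ≡⟨ cong (_* ∣ p i ∣) (ℚ.0≤p⇒∣p∣≡p (ℚ.<⇒≤ (ℚ.positive⁻¹ δ))) ⟩
    δ * ∣ p i ∣     <⟨ ℚ.*-monoʳ-<-pos δ (p<M i) ⟩
    ε * 1/ M * M    ≡⟨ ℚ.*-assoc ε (1/ M) M ⟩
    ε * (1/ M * M)  ≡⟨ cong (ε *_) (ℚ.*-inverseˡ M) ⟩
    ε * 1ℚ          ≡⟨ ℚ.*-identityʳ ε ⟩
    ε               ∎
  where
  open ℚ.≤-Reasoning
  instance
    _ = positive 0<M
    _ = ℚ.pos⇒nonZero M
    _ = positive 0<ε
    _ = ℚ.1/pos⇒pos M
  δ = ε * 1/ M
  instance
    δ-pos : Positive δ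
    δ-pos = ℚ.pos*pos⇒pos ε (1/ M)

light-part : ∀ n (f : Fin (suc n) → ℚ) → sumℚ f ≤ 1ℚ → ∃ λ i → ι (+ suc n) * f i ≤ 1ℚ
light-part n f Σf≤1 = below-average n (λ i → N * f i) 1ℚ
  (subst (_≤ N * 1ℚ) (*-sum N f) (ℚ.*-monoˡ-≤-nonNeg N {{nonNegative 0≤N}} Σf≤1))
  where
  N = ι (+ suc n)
  0≤N : 0ℚ ≤ N
  0≤N = ι-mono-≤ {+ 0} {+ suc n} (ℤ.+≤+ ℕ.z≤n)

-- `G` and `Q` stand for the values of a facet functional at a block of `z` and at `q`, and `C` for
-- the facet bound. If `N * G` reaches `C`, the functional increases along the ray, so the point
-- beyond `z` lies strictly outside this facet of `T / N`.
overshoot-< : ∀ N G Q C δ → 0ℚ < N → 0ℚ < δ → Q < C → C ≤ N * G → C < N * (G + δ * (N * G - Q))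
overshoot-< N G Q C δ 0<N 0<δ Q<C C≤NG = begin-strict
  C                         ≤⟨ C≤NG ⟩
  N * G                     ≡⟨ cong (N *_) (ℚ.+-identityʳ G) ⟨
  N * (G + 0ℚ)              ≡⟨ cong (λ t → N * (G + t)) (ℚ.*-zeroʳ δ) ⟨
  N * (G + δ * 0ℚ)          <⟨ ℚ.*-monoʳ-<-pos N {{positive 0<N}} (ℚ.+-monoʳ-< G
                                 (ℚ.*-monoʳ-<-pos δ {{positive 0<δ}} 0<NG-Q)) ⟩
  N * (G + δ * (N * G - Q)) ∎
  where
  open ℚ.≤-Reasoning
  0<NG-Q : 0ℚ < N * G - Q
  0<NG-Q = subst (_< N * G - Q) (ℚ.+-inverseʳ Q) (ℚ.+-monoˡ-< (- Q) (ℚ.<-≤-trans Q<C C≤NG))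

-- The weight missing from `N * sumℚ c ≤ 1ℚ` can be given to the origin, which satisfies the facet
-- inequality because `C` is nonnegative.
weighted-≤ : ∀ {d k} (T : Fin k → LatticePoint d) (g : LatticePoint d) C → + 0 ℤ.≤ C →
  (∀ e → evalℤ g (T e) ℤ.≤ C) → ∀ N → 0ℚ ≤ N → (c : Fin k → ℚ) → (∀ e → 0ℚ ≤ c e) → N * sumℚ c ≤ 1ℚ →
  N * eval g (λ b → sumℚ (λ e → c e * ι (T e b))) ≤ ι C
weighted-≤ {d} {k} T g C 0≤C T≤C N 0≤N c 0≤c Nc≤1 = begin
  N * eval g (λ b → sumℚ (λ e → c e * ι (T e b)))
    ≡⟨ cong (N *_) (eval-comb g c T) ⟩
  N * sumℚ (λ e → c e * eval g (toℚ (T e)))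
    ≤⟨ ℚ.*-monoˡ-≤-nonNeg N {{nonNegative 0≤N}} (sum-mono-≤ {k} (λ e → ℚ.*-monoˡ-≤-nonNeg (c e) {{nonNegative (0≤c e)}}
         (subst (_≤ ι C) (sym (eval-toℚ g (T e))) (ι-mono-≤ {evalℤ g (T e)} {C} (T≤C e))))) ⟩
  N * sumℚ (λ e → c e * ι C)
    ≡⟨ cong (N *_) (sum-* (ι C) c) ⟨
  N * (sumℚ c * ι C)
    ≡⟨ ℚ.*-assoc N (sumℚ c) (ι C) ⟨
  N * sumℚ c * ι C
    ≤⟨ ℚ.*-monoʳ-≤-nonNeg (ι C) {{nonNegative (ι-mono-≤ {+ 0} {C} 0≤C)}} Nc≤1 ⟩
  1ℚ * ι C
    ≡⟨ ℚ.*-identityˡ (ι C) ⟩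
  ι C ∎
  where open ℚ.≤-Reasoning

-- A block carrying at most the average share of the convex weights lies in T / n; the weights are
-- those of a point beyond z on the ray from the interior point (q / n, …, q / n), so z is strictly inside.
directSum-hollow : ∀ n {d k r} (T : Fin k → LatticePoint d) (g : Fin r → LatticePoint d) (C : Fin r → ℤ) →
  (∀ j → + 0 ℤ.≤ C j) → (∀ j e → evalℤ (g j) (T e) ℤ.≤ C j) →
  (q : LatticePoint d) → (∀ j → evalℤ (g j) q ℤ.< C j) →
  (∀ z → (∀ j → + suc n ℤ.* evalℤ (g j) z ℤ.< C j) → ⊥) →
  Hollow (directSum (suc n) T)
directSum-hollow n {d} {k} T g C 0≤C T≤C q q<C empty z (ε , 0<ε , box) =
  conclude (small-multiple (λ i → N * ι (z i) - qs i) ε 0<ε)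
  where
  N = ι (+ suc n)
  0<N : 0ℚ < N
  0<N = ι-mono-< {+ 0} {+ suc n} (ℤ.+<+ (ℕ.s≤s ℕ.z≤n))
  V = directSum (suc n) T
  qs : Fin (suc n ℕ.* d) → ℚ
  qs i = ι (q (proj₂ (remQuot {suc n} d i)))

  module _ (δ : ℚ) (0<δ : 0ℚ < δ) where
    y : Pointℚ (suc n ℕ.* d)
    y i = ι (z i) + δ * (N * ι (z i) - qs i)

    step : ∀ i → y i - ι (z i) ≡ δ * (N * ι (z i) - qs i)
    step i = solve 2 (λ a b → a :+ b :- a := b) refl (ι (z i)) (δ * (N * ι (z i) - qs i))

    eval-y : ∀ f a → eval f (blockOf a y) ≡
      ι (evalℤ f (blockOf a z)) + δ * (N * ι (evalℤ f (blockOf a z)) - ι (evalℤ f q))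
    eval-y f a = trans
      (eval-cong f λ b → cong (λ t → ι (blockOf a z b) + δ * (N * ι (blockOf a z b) - ι (q (proj₂ t))))
        (Fin.remQuot-combine a b))
      (trans (eval-overshoot f (toℚ (blockOf a z)) (toℚ q) δ N)
        (cong₂ (λ s t → s + δ * (N * s - t)) (eval-toℚ f (blockOf a z)) (eval-toℚ f q)))

    y∉conv : InConv V y → ⊥
    y∉conv (λs , 0≤λ , Σλ≡1 , Σλv≡y) = empty (blockOf a z) strict
      where
      S : Fin (suc n) → ℚ
      S a = sumℚ {k} (blockOf a (λs ∘ suc))
      -- Only an inequality, since the origin carries the rest of the weight.
      ΣS≤1 : sumℚ S ≤ 1ℚ
      ΣS≤1 = subst₂ _≤_ (ℚ.+-identityˡ (sumℚ S)) (trans (sym (sum-directSum (suc n) {k} λs)) Σλ≡1)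
        (ℚ.+-monoˡ-≤ (sumℚ S) (0≤λ zero))
      a = proj₁ (light-part n S ΣS≤1)
      N*y≤C : ∀ j → N * eval (g j) (blockOf a y) ≤ ι (C j)
      N*y≤C j = subst (λ t → N * t ≤ ι (C j))
        (eval-cong (g j) (λ b → trans (sym (directSum-coordinate (suc n) T λs a b)) (Σλv≡y (combine a b))))
        (weighted-≤ T (g j) (C j) (0≤C j) (T≤C j) N (ℚ.<⇒≤ 0<N) (blockOf a (λs ∘ suc)) (λ e → 0≤λ (suc (combine a e)))
          (proj₂ (light-part n S ΣS≤1)))
      -- Otherwise block `a` of `z` is on or beyond the facet, and moving further away from `q / N`
      -- contradicts `N*y≤C`.
      strict : ∀ j → + suc n ℤ.* evalℤ (g j) (blockOf a z) ℤ.< C j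
      strict j = ℤ.≰⇒> λ C≤NG → ℚ.<-irrefl refl (ℚ.<-≤-trans
        (overshoot-< N (ι (evalℤ (g j) (blockOf a z))) (ι (evalℤ (g j) q)) (ι (C j)) δ 0<N 0<δ (ι-mono-< {evalℤ (g j) q} {C j} (q<C j))
          (subst (ι (C j) ≤_) (ι-* (+ suc n) (evalℤ (g j) (blockOf a z)))
            (ι-mono-≤ {C j} {+ suc n ℤ.* evalℤ (g j) (blockOf a z)} C≤NG)))
        (subst (λ t → N * t ≤ ι (C j)) (eval-y (g j) a) (N*y≤C j)))

  conclude : (∃ λ δ → 0ℚ < δ × (∀ i → ∣ δ * (N * ι (z i) - qs i) ∣ < ε)) → ⊥
  conclude (δ , 0<δ , small) = y∉conv δ 0<δ
    (box (y δ 0<δ) λ i → subst (λ t → ∣ t ∣ < ε) (sym (step δ 0<δ i)) (small i))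

-- Finite checks for the two blocks

wide? : ∀ {d m} w (V : Fin m → LatticePoint d) f → Dec (Wide w V f)
wide? w V f = Fin.any? λ i → Fin.any? λ i′ → + w ℤ.≤? evalℤ f (V i) ℤ.- evalℤ f (V i′)

∣∣-< : ∀ i {n} → i ℤ.< + n → ℤ.- i ℤ.< + n → ℤ.∣ i ∣ ℕ.< n
∣∣-< (+ _)      (ℤ.+<+ i<n) _            = i<n
∣∣-< -[1+ _ ]   _           (ℤ.+<+ -i<n) = -i<n

-- Both orders of a pair of points fail, which bounds the absolute value. Such bounds leave only
-- finitely many functionals to search.
¬wide⇒∣∣< : ∀ {d m} w (V : Fin m → LatticePoint d) f → ¬ Wide w V f →
  ∀ i i′ → ℤ.∣ evalℤ f (V i) ℤ.- evalℤ f (V i′) ∣ ℕ.< w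
¬wide⇒∣∣< w V f ¬wide i i′ = ∣∣-< _
  (ℤ.≰⇒> λ w≤ → ¬wide (i , i′ , w≤))
  (ℤ.≰⇒> λ w≤ → ¬wide (i′ , i , subst (+ w ℤ.≤_) (swap (evalℤ f (V i)) (evalℤ f (V i′))) w≤))
  where
  swap : ∀ a b → ℤ.- (a ℤ.- b) ≡ b ℤ.- a
  swap = solve-∀

all-bounded? : ∀ {P : ℤ → Set} B → (∀ z → Dec (P z)) → Dec (∀ z → ℤ.∣ z ∣ ℕ.≤ B → P z)
all-bounded? {P} B P? = map′ to from
  -- Zero counts among the nonnegative values, hence `suc B` of them against `B` negative ones.
  (Fin.all? {suc B} (λ i → P? (+ toℕ i)) ×-dec Fin.all? {B} (λ i → P? -[1+ toℕ i ]))
  where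
  to : (∀ (i : Fin (suc B)) → P (+ toℕ i)) × (∀ (i : Fin B) → P -[1+ toℕ i ]) → ∀ z → ℤ.∣ z ∣ ℕ.≤ B → P z
  to (pos , neg) (+ n)    n≤B = subst (λ t → P (+ t)) (Fin.toℕ-fromℕ< (ℕ.s≤s n≤B)) (pos (fromℕ< (ℕ.s≤s n≤B)))
  to (pos , neg) -[1+ n ] n<B = subst (λ t → P -[1+ t ]) (Fin.toℕ-fromℕ< n<B) (neg (fromℕ< n<B))
  from : (∀ z → ℤ.∣ z ∣ ℕ.≤ B → P z) → (∀ (i : Fin (suc B)) → P (+ toℕ i)) × (∀ (i : Fin B) → P -[1+ toℕ i ])
  from h = (λ i → h (+ toℕ i) (ℕ.s≤s⁻¹ (Fin.toℕ<n i))) , λ i → h -[1+ toℕ i ] (Fin.toℕ<n i)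

-- Factor and bound enter through their predecessors: the arguments `34 1` mean that 35 times `i` is
-- below 70 in absolute value.
∣c*i∣<⇒∣i∣≤ : ∀ c b i → ℤ.∣ + suc c ℤ.* i ∣ ℕ.< suc c ℕ.* suc b → ℤ.∣ i ∣ ℕ.≤ b
∣c*i∣<⇒∣i∣≤ c b i lt = ℕ.s≤s⁻¹ (ℕ.*-cancelˡ-< (suc c) ℤ.∣ i ∣ (suc b)
  (subst (ℕ._< suc c ℕ.* suc b) (ℤ.∣i*j∣≡∣i∣*∣j∣ (+ suc c) i) lt))

∣i+c*j∣≤ : ∀ a b i c j → ℤ.∣ i ∣ ℕ.≤ a → ℤ.∣ j ∣ ℕ.≤ b → ℤ.∣ i ℤ.+ c ℤ.* j ∣ ℕ.≤ a ℕ.+ ℤ.∣ c ∣ ℕ.* b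
∣i+c*j∣≤ a b i c j i≤a j≤b = ℕ.≤-trans (ℤ.∣i+j∣≤∣i∣+∣j∣ i (c ℤ.* j))
  (ℕ.+-mono-≤ i≤a (subst (ℕ._≤ _) (sym (ℤ.∣i*j∣≡∣i∣*∣j∣ c j)) (ℕ.*-monoʳ-≤ ℤ.∣ c ∣ j≤b)))

-- Seven times a rational approximation of Hurkens' triangle, placed so that 0, (7 , 0) and (0 , 7) lie on
-- its three edges.
triangle : Fin 3 → LatticePoint 2
triangle e = lookup (lookup ((-[1+ 5 ] ∷ + 4 ∷ []) ∷ (+ 4 ∷ + 9 ∷ []) ∷ (+ 9 ∷ -[1+ 5 ] ∷ []) ∷ []) e)

-- With the bounds below, the edges are -2x - 3y ≤ 0, 3x + y ≤ 21 and -x + 2y ≤ 14, carrying 0, (7,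
-- 0) and (0, 7) in this order.
triangle-facets : Fin 3 → LatticePoint 2
triangle-facets j = lookup (lookup ((-[1+ 1 ] ∷ -[1+ 2 ] ∷ []) ∷ (+ 3 ∷ + 1 ∷ []) ∷ (-[1+ 0 ] ∷ + 2 ∷ []) ∷ []) j)

triangle-bounds : Fin 3 → ℤ
triangle-bounds = lookup (+ 0 ∷ + 21 ∷ + 14 ∷ [])

-- Up to sign, the adjugate of the matrix with rows (4, 9) and (9, -6), whose determinant is -105;
-- hence the parameter 104 below.
triangle-dual : Fin 2 → LatticePoint 2
triangle-dual e = lookup (lookup ((+ 6 ∷ + 9 ∷ []) ∷ (+ 9 ∷ -[1+ 3 ] ∷ []) ∷ []) e)

on-diagonal? : ∀ {d k} (T φ : Fin k → LatticePoint d) D → Dec (∀ e → evalℤ (φ e) (T e) ≡ + suc D)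
on-diagonal? T φ D = Fin.all? λ e → evalℤ (φ e) (T e) ℤ.≟ + suc D

off-diagonal? : ∀ {d k} (T φ : Fin k → LatticePoint d) → Dec (∀ e e′ → e ≢ e′ → evalℤ (φ e) (T e′) ≡ + 0)
off-diagonal? T φ = Fin.all? λ e → Fin.all? λ e′ → ¬? (e Fin.≟ e′) →-dec (evalℤ (φ e) (T e′) ℤ.≟ + 0)

triangle-independent : LinearlyIndependent (triangle ∘ suc)
triangle-independent = dual⇒linearlyIndependent (triangle ∘ suc) triangle-dual 104
  (toWitness {a? = on-diagonal? (triangle ∘ suc) triangle-dual 104} _)
  (toWitness {a? = off-diagonal? (triangle ∘ suc) triangle-dual} _)

facets? : ∀ {d k r} (T : Fin k → LatticePoint d) (g : Fin r → LatticePoint d) (C : Fin r → ℤ) →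
  Dec (∀ j e → evalℤ (g j) (T e) ℤ.≤ C j)
facets? T g C = Fin.all? λ j → Fin.all? λ e → evalℤ (g j) (T e) ℤ.≤? C j

strictFacets? : ∀ {d r} (q : LatticePoint d) (g : Fin r → LatticePoint d) (C : Fin r → ℤ) →
  Dec (∀ j → evalℤ (g j) q ℤ.< C j)
strictFacets? q g C = Fin.all? λ j → evalℤ (g j) q ℤ.<? C j

nonNegative? : ∀ {r} (C : Fin r → ℤ) → Dec (∀ j → + 0 ℤ.≤ C j)
nonNegative? C = Fin.all? λ j → + 0 ℤ.≤? C j

range? : ∀ {d k} (T : Fin k → LatticePoint d) f lo hi →
  Dec (∀ e → lo ℤ.≤ evalℤ f (T e) × evalℤ f (T e) ℤ.≤ hi)
range? T f lo hi = Fin.all? λ e → (lo ℤ.≤? evalℤ f (T e)) ×-dec (evalℤ f (T e) ℤ.≤? hi)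

≡0-by-bounds : ∀ c z → + suc c ℤ.* z ℤ.< + suc c → ℤ.- (+ suc c ℤ.* z) ℤ.< + suc c → z ≡ + 0
≡0-by-bounds c z cz<c -cz<c = ℤ.∣i∣≡0⇒i≡0 (ℕ.n≤0⇒n≡0 (∣c*i∣<⇒∣i∣≤ c 0 z
  (subst (ℤ.∣ + suc c ℤ.* z ∣ ℕ.<_) (sym (ℕ.*-identityʳ (suc c))) (∣∣-< (+ suc c ℤ.* z) cz<c -cz<c))))

-- Integrality sharpens the strict inequalities to `u ≤ -1`, `v ≤ 2`, `w ≤ 1`. The combinations 7x =
-- u + 3v, -7x = 2u + 3w, 7y = v + 3w and -7y = 3u + 2v then force x = y = 0, but the origin lies on
-- the edge u = 0.
triangle-empty : ∀ z → (∀ j → + 7 ℤ.* evalℤ (triangle-facets j) z ℤ.< triangle-bounds j) → ⊥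
triangle-empty z inside = ℤ.<-irrefl refl (subst (ℤ._< + 0) u≡0 u<0)
  where
  x = z zero
  y = z (suc zero)
  u = evalℤ (triangle-facets zero) z
  v = evalℤ (triangle-facets (suc zero)) z
  w = evalℤ (triangle-facets (suc (suc zero))) z
  u<0 : u ℤ.< + 0
  u<0 = ℤ.*-cancelˡ-<-nonNeg {j = + 0} (+ 7) (inside zero)
  u≤-1 : u ℤ.≤ -[1+ 0 ]
  u≤-1 = ℤ.i<j⇒i≤pred[j] u<0
  v≤2 : v ℤ.≤ + 2
  v≤2 = ℤ.i<j⇒i≤pred[j] (ℤ.*-cancelˡ-<-nonNeg {j = + 3} (+ 7) (inside (suc zero)))
  w≤1 : w ℤ.≤ + 1
  w≤1 = ℤ.i<j⇒i≤pred[j] (ℤ.*-cancelˡ-<-nonNeg {j = + 2} (+ 7) (inside (suc (suc zero))))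
  combine-≤ : ∀ a {i j} b {k l} → i ℤ.≤ j → k ℤ.≤ l → + a ℤ.* i ℤ.+ + b ℤ.* k ℤ.≤ + a ℤ.* j ℤ.+ + b ℤ.* l
  combine-≤ a b i≤j k≤l = ℤ.+-mono-≤ (ℤ.*-monoˡ-≤-nonNeg (+ a) i≤j) (ℤ.*-monoˡ-≤-nonNeg (+ b) k≤l)
  x≡0 : x ≡ + 0
  x≡0 = ≡0-by-bounds 6 x
    (ℤ.≤-<-trans (subst (ℤ._≤ + 5) (eq₁ x y) (combine-≤ 1 3 u≤-1 v≤2)) (ℤ.+<+ (ℕ.m≤m+n 6 1)))
    (ℤ.≤-<-trans (subst (ℤ._≤ + 1) (eq₂ x y) (combine-≤ 2 3 u≤-1 w≤1)) (ℤ.+<+ (ℕ.m≤m+n 2 5)))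
    where
    eq₁ : ∀ x y →
      + 1 ℤ.* (-[1+ 1 ] ℤ.* x ℤ.+ (-[1+ 2 ] ℤ.* y ℤ.+ + 0)) ℤ.+ + 3 ℤ.* (+ 3 ℤ.* x ℤ.+ (+ 1 ℤ.* y ℤ.+ + 0)) ≡ + 7 ℤ.* x
    eq₁ = solve-∀
    eq₂ : ∀ x y →
      + 2 ℤ.* (-[1+ 1 ] ℤ.* x ℤ.+ (-[1+ 2 ] ℤ.* y ℤ.+ + 0)) ℤ.+ + 3 ℤ.* (-[1+ 0 ] ℤ.* x ℤ.+ (+ 2 ℤ.* y ℤ.+ + 0)) ≡ ℤ.- (+ 7 ℤ.* x)
    eq₂ = solve-∀
  y≡0 : y ≡ + 0
  y≡0 = ≡0-by-bounds 6 y
    (ℤ.≤-<-trans (subst (ℤ._≤ + 5) (eq₁ x y) (combine-≤ 1 3 v≤2 w≤1)) (ℤ.+<+ (ℕ.m≤m+n 6 1)))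
    (ℤ.≤-<-trans (subst (ℤ._≤ + 1) (eq₂ x y) (combine-≤ 3 2 u≤-1 v≤2)) (ℤ.+<+ (ℕ.m≤m+n 2 5)))
    where
    eq₁ : ∀ x y →
      + 1 ℤ.* (+ 3 ℤ.* x ℤ.+ (+ 1 ℤ.* y ℤ.+ + 0)) ℤ.+ + 3 ℤ.* (-[1+ 0 ] ℤ.* x ℤ.+ (+ 2 ℤ.* y ℤ.+ + 0)) ≡ + 7 ℤ.* y
    eq₁ = solve-∀
    eq₂ : ∀ x y →
      + 3 ℤ.* (-[1+ 1 ] ℤ.* x ℤ.+ (-[1+ 2 ] ℤ.* y ℤ.+ + 0)) ℤ.+ + 2 ℤ.* (+ 3 ℤ.* x ℤ.+ (+ 1 ℤ.* y ℤ.+ + 0)) ≡ ℤ.- (+ 7 ℤ.* y)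
    eq₂ = solve-∀
  u≡0 : u ≡ + 0
  u≡0 = cong₂ (λ x y → -[1+ 1 ] ℤ.* x ℤ.+ (-[1+ 2 ] ℤ.* y ℤ.+ + 0)) x≡0 y≡0

triangle-wide : ∀ f → Nonzero f → Wide 15 (withOrigin triangle) f
triangle-wide f f≢0 with wide? 15 (withOrigin triangle) f
... | yes wide = wide
-- `f` and `vec p q` agree only pointwise, but `evalℤ` unfolds in dimension 2, so the two `Wide`
-- types coincide by computation.
... | no ¬wide = small p ∣p∣≤1 q ∣q∣≤1 f≢0′
  where
  p = f zero
  q = f (suc zero)
  vec : ℤ → ℤ → Fin 2 → ℤ
  vec p q = lookup (p ∷ q ∷ [])
  f≢0′ : ¬ (p ≡ + 0 × q ≡ + 0)
  f≢0′ (p≡0 , q≡0) = case f≢0 of λ { (zero , p≢0) → p≢0 p≡0 ; (suc zero , q≢0) → q≢0 q≡0 }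
  s = + 3 ℤ.* p ℤ.- + 2 ℤ.* q
  t = + 4 ℤ.* p ℤ.+ + 9 ℤ.* q
  ∣s∣≤2 : ℤ.∣ s ∣ ℕ.≤ 2
  ∣s∣≤2 = ∣c*i∣<⇒∣i∣≤ 4 2 s
    (subst (λ i → ℤ.∣ i ∣ ℕ.< 15) (eq p q) (¬wide⇒∣∣< 15 (withOrigin triangle) f ¬wide (suc (suc (suc zero))) (suc zero)))
    where
    eq : ∀ p q → (p ℤ.* + 9 ℤ.+ (q ℤ.* -[1+ 5 ] ℤ.+ + 0)) ℤ.- (p ℤ.* -[1+ 5 ] ℤ.+ (q ℤ.* + 4 ℤ.+ + 0)) ≡
      + 5 ℤ.* (+ 3 ℤ.* p ℤ.- + 2 ℤ.* q)
    eq = solve-∀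
  ∣t∣≤14 : ℤ.∣ t ∣ ℕ.≤ 14
  ∣t∣≤14 = ℕ.s≤s⁻¹ (subst (λ i → ℤ.∣ i ∣ ℕ.< 15) (eq p q) (¬wide⇒∣∣< 15 (withOrigin triangle) f ¬wide (suc (suc zero)) zero))
    where
    eq : ∀ p q → (p ℤ.* + 4 ℤ.+ (q ℤ.* + 9 ℤ.+ + 0)) ℤ.- (p ℤ.* + 0 ℤ.+ (q ℤ.* + 0 ℤ.+ + 0)) ≡ + 4 ℤ.* p ℤ.+ + 9 ℤ.* q
    eq = solve-∀
  ∣p∣≤1 : ℤ.∣ p ∣ ℕ.≤ 1
  ∣p∣≤1 = ∣c*i∣<⇒∣i∣≤ 34 1 p (ℕ.≤-<-trans (subst (λ i → ℤ.∣ i ∣ ℕ.≤ 46) (eq p q)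
      (∣i+c*j∣≤ 18 14 (+ 0 ℤ.+ + 9 ℤ.* s) (+ 2) t (∣i+c*j∣≤ 0 2 (+ 0) (+ 9) s ℕ.z≤n ∣s∣≤2) ∣t∣≤14)) (ℕ.m≤m+n 47 23))
    where
    eq : ∀ p q → + 0 ℤ.+ + 9 ℤ.* (+ 3 ℤ.* p ℤ.- + 2 ℤ.* q) ℤ.+ + 2 ℤ.* (+ 4 ℤ.* p ℤ.+ + 9 ℤ.* q) ≡ + 35 ℤ.* p
    eq = solve-∀
  ∣q∣≤1 : ℤ.∣ q ∣ ℕ.≤ 1
  ∣q∣≤1 = ∣c*i∣<⇒∣i∣≤ 34 1 q (ℕ.≤-<-trans (subst (λ i → ℤ.∣ i ∣ ℕ.≤ 50) (eq p q)
      (∣i+c*j∣≤ 42 2 (+ 0 ℤ.+ + 3 ℤ.* t) (-[1+ 3 ]) s (∣i+c*j∣≤ 0 14 (+ 0) (+ 3) t ℕ.z≤n ∣t∣≤14) ∣s∣≤2)) (ℕ.m≤m+n 51 19))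
    where
    eq : ∀ p q → + 0 ℤ.+ + 3 ℤ.* (+ 4 ℤ.* p ℤ.+ + 9 ℤ.* q) ℤ.+ -[1+ 3 ] ℤ.* (+ 3 ℤ.* p ℤ.- + 2 ℤ.* q) ≡ + 35 ℤ.* q
    eq = solve-∀
  small? : Dec (∀ p → ℤ.∣ p ∣ ℕ.≤ 1 → ∀ q → ℤ.∣ q ∣ ℕ.≤ 1 →
    ¬ (p ≡ + 0 × q ≡ + 0) → Wide 15 (withOrigin triangle) (vec p q))
  small? = all-bounded? 1 λ p → all-bounded? 1 λ q →
    ¬? ((p ℤ.≟ + 0) ×-dec (q ℤ.≟ + 0)) →-dec wide? 15 (withOrigin triangle) (vec p q)
  small : ∀ p → ℤ.∣ p ∣ ℕ.≤ 1 → ∀ q → ℤ.∣ q ∣ ℕ.≤ 1 →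
    ¬ (p ≡ + 0 × q ≡ + 0) → Wide 15 (withOrigin triangle) (vec p q)
  small = toWitness {a? = small?} _

polytope14 : Σ ℕ λ m → Σ (Fin m → LatticePoint 14) λ V → FullDimensional V × Hollow V × LatticeWidth V 15
polytope14 = 22 , directSum 7 triangle ,
  directSum-fullDimensional 7 triangle suc triangle-independent ,
  directSum-hollow 6 triangle triangle-facets triangle-bounds
    (toWitness {a? = nonNegative? triangle-bounds} _)
    (toWitness {a? = facets? triangle triangle-facets triangle-bounds} _)
    -- (1, 1) is an interior point of the triangle.
    (lookup (+ 1 ∷ + 1 ∷ []))
    (toWitness {a? = strictFacets? (lookup (+ 1 ∷ + 1 ∷ [])) triangle-facets triangle-bounds} _)
    triangle-empty ,
  -- The first coordinate runs from -6 to 9 on the triangle.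
  directSum-width 6 triangle 15 triangle-wide (lookup (+ 1 ∷ + 0 ∷ [])) (zero , λ ())
    -[1+ 5 ] (+ 9) ℤ.-≤+ (ℤ.+≤+ ℕ.z≤n) ℤ.≤-refl
    (toWitness {a? = range? triangle (lookup (+ 1 ∷ + 0 ∷ [])) -[1+ 5 ] (+ 9)} _)

-- 102 times the Haase–Ziegler empty simplex of width 4 and normalised volume 101.
simplex : Fin 4 → LatticePoint 4
simplex e = lookup (lookup
  ( (+ 102 ∷ + 0 ∷ + 0 ∷ + 0 ∷ [])
  ∷ (+ 0 ∷ + 102 ∷ + 0 ∷ + 0 ∷ [])
  ∷ (+ 0 ∷ + 0 ∷ + 102 ∷ + 0 ∷ [])
  ∷ (+ 612 ∷ + 1428 ∷ + 1734 ∷ + 10302 ∷ []) ∷ []) e)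

-- The barycentric coordinates at the four nonzero vertices, multiplied by 10302 = 101 · 102.
simplex-dual : Fin 4 → LatticePoint 4
simplex-dual e = lookup (lookup
  ( (+ 101 ∷ + 0 ∷ + 0 ∷ -[1+ 5 ] ∷ [])
  ∷ (+ 0 ∷ + 101 ∷ + 0 ∷ -[1+ 13 ] ∷ [])
  ∷ (+ 0 ∷ + 0 ∷ + 101 ∷ -[1+ 16 ] ∷ [])
  ∷ (+ 0 ∷ + 0 ∷ + 0 ∷ + 1 ∷ []) ∷ []) e)

-- The first functional is the sum of the rows of `simplex-dual` (-36 = 1 - 6 - 14 - 17) and bounds
-- the facet opposite the origin; the others bound the facets through the origin.
simplex-facets : Fin 5 → LatticePoint 4
simplex-facets zero    = lookup (+ 101 ∷ + 101 ∷ + 101 ∷ -[1+ 35 ] ∷ [])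
simplex-facets (suc e) = λ b → ℤ.- simplex-dual e b

simplex-bounds : Fin 5 → ℤ
simplex-bounds = lookup (+ 10302 ∷ + 0 ∷ + 0 ∷ + 0 ∷ + 0 ∷ [])

simplex-independent : LinearlyIndependent simplex
simplex-independent = dual⇒linearlyIndependent simplex simplex-dual 10301
  (toWitness {a? = on-diagonal? simplex simplex-dual 10301} _)
  (toWitness {a? = off-diagonal? simplex simplex-dual} _)

-- The least integer strictly above `c * n / 101` is the floor plus one, also when 101 divides
-- `c * n`.
⌊⌋-bound : ∀ c n x → + c ℤ.* + n ℤ.< + 101 ℤ.* x → + suc (c ℕ.* n ℕ./ 101) ℤ.≤ x
⌊⌋-bound c n x cn<101x = ℤ.i<j⇒suc[i]≤j (ℤ.*-cancelˡ-<-nonNeg {+ (c ℕ.* n ℕ./ 101)} {x} (+ 101) (ℤ.≤-<-trans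
  (subst₂ ℤ._≤_ (ℤ.pos-* 101 (c ℕ.* n ℕ./ 101)) (ℤ.pos-* c n)
    (ℤ.+≤+ (subst (ℕ._≤ c ℕ.* n) (ℕ.*-comm (c ℕ.* n ℕ./ 101) 101) (ℕ.m/n*n≤m (c ℕ.* n) 101))))
  cn<101x))

least-x₁+x₂+x₃ : ℕ → ℕ
least-x₁+x₂+x₃ n = suc (6 ℕ.* n ℕ./ 101) ℕ.+ suc (14 ℕ.* n ℕ./ 101) ℕ.+ suc (17 ℕ.* n ℕ./ 101)

-- For a lattice point (x₁, x₂, x₃, n) of the simplex with vertices 0, e₁, e₂, e₃, (6, 14, 17, 101), the
-- barycentric coordinates, scaled by 101, are 101 x₁ − 6 n, 101 x₂ − 14 n, 101 x₃ − 17 n and n,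
-- with sum 101 (x₁ + x₂ + x₃) − 36 n.
no-interior-residue : ∀ {n} → n ℕ.< 99 → 0 ℕ.< n → ¬ (101 ℕ.* least-x₁+x₂+x₃ n ℕ.≤ 101 ℕ.+ 36 ℕ.* n)
no-interior-residue = toWitness {a? = ℕ.allUpTo? (λ n → (0 ℕ.<? n) →-dec
  ¬? (101 ℕ.* least-x₁+x₂+x₃ n ℕ.≤? 101 ℕ.+ 36 ℕ.* n)) 99} _

-- Dividing the first inequality by 101 gives `v < 102`, so `v ≤ 101` by integrality: the bound of
-- the undilated simplex. As `t` is `v + u₁ + u₂ + u₃` with each `uᵢ ≤ -1`, only `t` from 1 to 98
-- remains. There the lower bounds on the other coordinates already exceed the upper bound `total`
-- on their sum.
simplex-empty : ∀ z → (∀ j → + 101 ℤ.* evalℤ (simplex-facets j) z ℤ.< simplex-bounds j) → ⊥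
simplex-empty z inside = no-interior-residue
  (ℕ.s≤s (ℤ.drop‿+≤+ (subst (ℤ._≤ + 98) t≡n t≤98)))
  (ℤ.drop‿+<+ (subst (+ 0 ℤ.<_) t≡n 0<t))
  (ℤ.drop‿+≤+ (subst₂ ℤ._≤_ (sym (ℤ.pos-* 101 (least-x₁+x₂+x₃ n))) rhs (ℤ.≤-trans
    (ℤ.*-monoˡ-≤-nonNeg (+ 101) (ℤ.+-mono-≤ (ℤ.+-mono-≤
      (⌊⌋-bound 6 n x₁ (subst (λ t → + 6 ℤ.* t ℤ.< + 101 ℤ.* x₁) t≡n 6t<101x₁))
      (⌊⌋-bound 14 n x₂ (subst (λ t → + 14 ℤ.* t ℤ.< + 101 ℤ.* x₂) t≡n 14t<101x₂)))
      (⌊⌋-bound 17 n x₃ (subst (λ t → + 17 ℤ.* t ℤ.< + 101 ℤ.* x₃) t≡n 17t<101x₃))))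
    total)))
  where
  x₁ = z zero
  x₂ = z (suc zero)
  x₃ = z (suc (suc zero))
  t = z (suc (suc (suc zero)))
  n = ℤ.∣ t ∣
  v = evalℤ (simplex-facets zero) z
  u₁ = evalℤ (simplex-facets (suc zero)) z
  u₂ = evalℤ (simplex-facets (suc (suc zero))) z
  u₃ = evalℤ (simplex-facets (suc (suc (suc zero)))) z
  u₄ = evalℤ (simplex-facets (suc (suc (suc (suc zero))))) z
  v≤101 : v ℤ.≤ + 101
  v≤101 = ℤ.i<j⇒i≤pred[j] (ℤ.*-cancelˡ-<-nonNeg {v} {+ 102} (+ 101) (inside zero))
  u₁<0 : u₁ ℤ.< + 0
  u₁<0 = ℤ.*-cancelˡ-<-nonNeg {u₁} {+ 0} (+ 101) (inside (suc zero))
  u₂<0 : u₂ ℤ.< + 0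
  u₂<0 = ℤ.*-cancelˡ-<-nonNeg {u₂} {+ 0} (+ 101) (inside (suc (suc zero)))
  u₃<0 : u₃ ℤ.< + 0
  u₃<0 = ℤ.*-cancelˡ-<-nonNeg {u₃} {+ 0} (+ 101) (inside (suc (suc (suc zero))))
  u₄<0 : u₄ ℤ.< + 0
  u₄<0 = ℤ.*-cancelˡ-<-nonNeg {u₄} {+ 0} (+ 101) (inside (suc (suc (suc (suc zero)))))
  add-<0 : ∀ i {u} → u ℤ.< + 0 → i ℤ.+ u ℤ.< i
  add-<0 i u<0 = subst (i ℤ.+ _ ℤ.<_) (ℤ.+-identityʳ i) (ℤ.+-monoʳ-< i u<0)
  6t<101x₁ : + 6 ℤ.* t ℤ.< + 101 ℤ.* x₁
  6t<101x₁ = subst (ℤ._< + 101 ℤ.* x₁) (eq x₁ x₂ x₃ t) (add-<0 (+ 101 ℤ.* x₁) u₁<0)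
    where
    eq : ∀ x y w t → + 101 ℤ.* x ℤ.+ (-[1+ 100 ] ℤ.* x ℤ.+ (+ 0 ℤ.* y ℤ.+ (+ 0 ℤ.* w ℤ.+ (+ 6 ℤ.* t ℤ.+ + 0)))) ≡ + 6 ℤ.* t
    eq = solve-∀
  14t<101x₂ : + 14 ℤ.* t ℤ.< + 101 ℤ.* x₂
  14t<101x₂ = subst (ℤ._< + 101 ℤ.* x₂) (eq x₁ x₂ x₃ t) (add-<0 (+ 101 ℤ.* x₂) u₂<0)
    where
    eq : ∀ x y w t → + 101 ℤ.* y ℤ.+ (+ 0 ℤ.* x ℤ.+ (-[1+ 100 ] ℤ.* y ℤ.+ (+ 0 ℤ.* w ℤ.+ (+ 14 ℤ.* t ℤ.+ + 0)))) ≡ + 14 ℤ.* t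
    eq = solve-∀
  17t<101x₃ : + 17 ℤ.* t ℤ.< + 101 ℤ.* x₃
  17t<101x₃ = subst (ℤ._< + 101 ℤ.* x₃) (eq x₁ x₂ x₃ t) (add-<0 (+ 101 ℤ.* x₃) u₃<0)
    where
    eq : ∀ x y w t → + 101 ℤ.* w ℤ.+ (+ 0 ℤ.* x ℤ.+ (+ 0 ℤ.* y ℤ.+ (-[1+ 100 ] ℤ.* w ℤ.+ (+ 17 ℤ.* t ℤ.+ + 0)))) ≡ + 17 ℤ.* t
    eq = solve-∀
  0<t : + 0 ℤ.< t
  0<t = subst (ℤ._< t) (eq x₁ x₂ x₃ t) (add-<0 t u₄<0)
    where
    eq : ∀ x y w t → t ℤ.+ (+ 0 ℤ.* x ℤ.+ (+ 0 ℤ.* y ℤ.+ (+ 0 ℤ.* w ℤ.+ (-[1+ 0 ] ℤ.* t ℤ.+ + 0)))) ≡ + 0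
    eq = solve-∀
  t≡n : t ≡ + n
  t≡n = sym (ℤ.0≤i⇒+∣i∣≡i (ℤ.<⇒≤ 0<t))
  t≤98 : t ℤ.≤ + 98
  t≤98 = subst (ℤ._≤ + 98) (eq x₁ x₂ x₃ t)
    (ℤ.+-mono-≤ v≤101 (ℤ.+-mono-≤ (ℤ.i<j⇒i≤pred[j] u₁<0) (ℤ.+-mono-≤ (ℤ.i<j⇒i≤pred[j] u₂<0) (ℤ.i<j⇒i≤pred[j] u₃<0))))
    where
    eq : ∀ x y w t →
      (+ 101 ℤ.* x ℤ.+ (+ 101 ℤ.* y ℤ.+ (+ 101 ℤ.* w ℤ.+ (-[1+ 35 ] ℤ.* t ℤ.+ + 0)))) ℤ.+
      ((-[1+ 100 ] ℤ.* x ℤ.+ (+ 0 ℤ.* y ℤ.+ (+ 0 ℤ.* w ℤ.+ (+ 6 ℤ.* t ℤ.+ + 0)))) ℤ.+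
      ((+ 0 ℤ.* x ℤ.+ (-[1+ 100 ] ℤ.* y ℤ.+ (+ 0 ℤ.* w ℤ.+ (+ 14 ℤ.* t ℤ.+ + 0)))) ℤ.+
      (+ 0 ℤ.* x ℤ.+ (+ 0 ℤ.* y ℤ.+ (-[1+ 100 ] ℤ.* w ℤ.+ (+ 17 ℤ.* t ℤ.+ + 0)))))) ≡ t
    eq = solve-∀
  total : + 101 ℤ.* (x₁ ℤ.+ x₂ ℤ.+ x₃) ℤ.≤ + 101 ℤ.+ + 36 ℤ.* t
  total = subst (ℤ._≤ + 101 ℤ.+ + 36 ℤ.* t) (eq x₁ x₂ x₃ t) (ℤ.+-monoˡ-≤ (+ 36 ℤ.* t) v≤101)
    where
    eq : ∀ x y w t → (+ 101 ℤ.* x ℤ.+ (+ 101 ℤ.* y ℤ.+ (+ 101 ℤ.* w ℤ.+ (-[1+ 35 ] ℤ.* t ℤ.+ + 0)))) ℤ.+ + 36 ℤ.* t ≡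
      + 101 ℤ.* (x ℤ.+ y ℤ.+ w)
    eq = solve-∀
  rhs : + 101 ℤ.+ + 36 ℤ.* t ≡ + (101 ℕ.+ 36 ℕ.* n)
  rhs = cong (λ i → + 101 ℤ.+ i) (trans (cong (+ 36 ℤ.*_) t≡n) (sym (ℤ.pos-* 36 n)))

-- If the width were below 408 = 4 · 102, the four edges at the origin would bound `p`, `q`, `s` and
-- `r` by 3. Then 101 `u` = `r` - 6 `p` - 14 `q` - 17 `s` is at most 114 in absolute value, so `u`
-- is at most 1, and the remaining functionals are checked one by one.
simplex-wide : ∀ f → Nonzero f → Wide 408 (withOrigin simplex) f
simplex-wide f f≢0 with wide? 408 (withOrigin simplex) f
... | yes wide = wide
... | no ¬wide = small p ∣p∣≤3 q ∣q∣≤3 s ∣s∣≤3 u ∣u∣≤1 f≢0′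
  where
  p = f zero
  q = f (suc zero)
  s = f (suc (suc zero))
  u = f (suc (suc (suc zero)))
  r = + 6 ℤ.* p ℤ.+ + 14 ℤ.* q ℤ.+ + 17 ℤ.* s ℤ.+ + 101 ℤ.* u
  vec : ℤ → ℤ → ℤ → ℤ → Fin 4 → ℤ
  vec p q s u = lookup (p ∷ q ∷ s ∷ u ∷ [])
  f≢0′ : ¬ (p ≡ + 0 × q ≡ + 0 × s ≡ + 0 × u ≡ + 0)
  f≢0′ (p≡0 , q≡0 , s≡0 , u≡0) = case f≢0 of λ
    { (zero , p≢0) → p≢0 p≡0 ; (suc zero , q≢0) → q≢0 q≡0
    ; (suc (suc zero) , s≢0) → s≢0 s≡0 ; (suc (suc (suc zero)) , u≢0) → u≢0 u≡0 }
  bound : ∀ i x → evalℤ f (withOrigin simplex i) ℤ.- evalℤ f (withOrigin simplex zero) ≡ + 102 ℤ.* x → ℤ.∣ x ∣ ℕ.≤ 3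
  bound i x eq = ∣c*i∣<⇒∣i∣≤ 101 3 x
    (subst (λ i → ℤ.∣ i ∣ ℕ.< 408) eq (¬wide⇒∣∣< 408 (withOrigin simplex) f ¬wide i zero))
  ∣p∣≤3 : ℤ.∣ p ∣ ℕ.≤ 3
  ∣p∣≤3 = bound (suc zero) p (eq p q s u)
    where
    eq : ∀ p q s u → (p ℤ.* + 102 ℤ.+ (q ℤ.* + 0 ℤ.+ (s ℤ.* + 0 ℤ.+ (u ℤ.* + 0 ℤ.+ + 0)))) ℤ.-
      (p ℤ.* + 0 ℤ.+ (q ℤ.* + 0 ℤ.+ (s ℤ.* + 0 ℤ.+ (u ℤ.* + 0 ℤ.+ + 0)))) ≡ + 102 ℤ.* p
    eq = solve-∀
  ∣q∣≤3 : ℤ.∣ q ∣ ℕ.≤ 3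
  ∣q∣≤3 = bound (suc (suc zero)) q (eq p q s u)
    where
    eq : ∀ p q s u → (p ℤ.* + 0 ℤ.+ (q ℤ.* + 102 ℤ.+ (s ℤ.* + 0 ℤ.+ (u ℤ.* + 0 ℤ.+ + 0)))) ℤ.-
      (p ℤ.* + 0 ℤ.+ (q ℤ.* + 0 ℤ.+ (s ℤ.* + 0 ℤ.+ (u ℤ.* + 0 ℤ.+ + 0)))) ≡ + 102 ℤ.* q
    eq = solve-∀
  ∣s∣≤3 : ℤ.∣ s ∣ ℕ.≤ 3
  ∣s∣≤3 = bound (suc (suc (suc zero))) s (eq p q s u)
    where
    eq : ∀ p q s u → (p ℤ.* + 0 ℤ.+ (q ℤ.* + 0 ℤ.+ (s ℤ.* + 102 ℤ.+ (u ℤ.* + 0 ℤ.+ + 0)))) ℤ.-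
      (p ℤ.* + 0 ℤ.+ (q ℤ.* + 0 ℤ.+ (s ℤ.* + 0 ℤ.+ (u ℤ.* + 0 ℤ.+ + 0)))) ≡ + 102 ℤ.* s
    eq = solve-∀
  ∣r∣≤3 : ℤ.∣ r ∣ ℕ.≤ 3
  ∣r∣≤3 = bound (suc (suc (suc (suc zero)))) r (eq p q s u)
    where
    eq : ∀ p q s u → (p ℤ.* + 612 ℤ.+ (q ℤ.* + 1428 ℤ.+ (s ℤ.* + 1734 ℤ.+ (u ℤ.* + 10302 ℤ.+ + 0)))) ℤ.-
      (p ℤ.* + 0 ℤ.+ (q ℤ.* + 0 ℤ.+ (s ℤ.* + 0 ℤ.+ (u ℤ.* + 0 ℤ.+ + 0)))) ≡
      + 102 ℤ.* (+ 6 ℤ.* p ℤ.+ + 14 ℤ.* q ℤ.+ + 17 ℤ.* s ℤ.+ + 101 ℤ.* u)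
    eq = solve-∀
  ∣u∣≤1 : ℤ.∣ u ∣ ℕ.≤ 1
  ∣u∣≤1 = ∣c*i∣<⇒∣i∣≤ 100 1 u (ℕ.≤-<-trans (subst (λ i → ℤ.∣ i ∣ ℕ.≤ 114) (eq p q s u)
      (∣i+c*j∣≤ 63 3 (r ℤ.+ -[1+ 5 ] ℤ.* p ℤ.+ -[1+ 13 ] ℤ.* q) -[1+ 16 ] s
        (∣i+c*j∣≤ 21 3 (r ℤ.+ -[1+ 5 ] ℤ.* p) -[1+ 13 ] q
          (∣i+c*j∣≤ 3 3 r -[1+ 5 ] p ∣r∣≤3 ∣p∣≤3) ∣q∣≤3) ∣s∣≤3))
      (ℕ.m≤m+n 115 87))
    where
    eq : ∀ p q s u → + 6 ℤ.* p ℤ.+ + 14 ℤ.* q ℤ.+ + 17 ℤ.* s ℤ.+ + 101 ℤ.* u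
      ℤ.+ -[1+ 5 ] ℤ.* p ℤ.+ -[1+ 13 ] ℤ.* q ℤ.+ -[1+ 16 ] ℤ.* s ≡ + 101 ℤ.* u
    eq = solve-∀
  Small : Set
  Small = ∀ p → ℤ.∣ p ∣ ℕ.≤ 3 → ∀ q → ℤ.∣ q ∣ ℕ.≤ 3 → ∀ s → ℤ.∣ s ∣ ℕ.≤ 3 → ∀ u → ℤ.∣ u ∣ ℕ.≤ 1 →
    ¬ (p ≡ + 0 × q ≡ + 0 × s ≡ + 0 × u ≡ + 0) → Wide 408 (withOrigin simplex) (vec p q s u)
  small? : Dec Small
  small? = all-bounded? 3 λ p → all-bounded? 3 λ q → all-bounded? 3 λ s → all-bounded? 1 λ u →
    ¬? ((p ℤ.≟ + 0) ×-dec (q ℤ.≟ + 0) ×-dec (s ℤ.≟ + 0) ×-dec (u ℤ.≟ + 0))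
      →-dec wide? 408 (withOrigin simplex) (vec p q s u)
  small : Small
  small = toWitness {a? = small?} _

simplex404 : Σ (Fin 405 → LatticePoint 404) λ V → AffinelyIndependent V × Hollow V × LatticeWidth V 408
simplex404 = directSum 101 simplex ,
  directSum-affinelyIndependent 101 simplex simplex-independent ,
  directSum-hollow 100 simplex simplex-facets simplex-bounds
    (toWitness {a? = nonNegative? simplex-bounds} _)
    (toWitness {a? = facets? simplex simplex-facets simplex-bounds} _)
    inner
    (toWitness {a? = strictFacets? inner simplex-facets simplex-bounds} _)
    simplex-empty ,
  directSum-width 100 simplex 408 simplex-wide f₀ (zero , λ ())
    -[1+ 203 ] (+ 204) ℤ.-≤+ (ℤ.+≤+ ℕ.z≤n) ℤ.≤-refl
    (toWitness {a? = range? simplex f₀ -[1+ 203 ] (+ 204)} _)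
  where
  inner f₀ : LatticePoint 4
  -- The sum of the vertices of the undilated simplex; all five of its barycentric coordinates in
  -- the dilated one are positive.
  inner = lookup (+ 7 ∷ + 15 ∷ + 18 ∷ + 101 ∷ [])
  -- On the nonzero vertices this takes the values 102, 204, -204 and 0, the last because 6 + 2 · 14
  -- - 2 · 17 = 0.
  f₀ = lookup (+ 1 ∷ + 2 ∷ -[1+ 1 ] ∷ + 0 ∷ [])

theorem1p3 : (Σ ℕ λ m → Σ (Fin m → LatticePoint 14) λ V →
    FullDimensional V × Hollow V × LatticeWidth V 15)
    ×
    (Σ (Fin 405 → LatticePoint 404) λ V →
    AffinelyIndependent V × Hollow V × LatticeWidth V 408)
theorem1p3 = polytope14 , simplex404
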